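{- Let $\tau$ be a fixed non-monotone permutation. Then $t(n,\tau)=\Theta(\sqrt{n})$, i.e. there are constants $c_1,c_2>0$ (depending on $\tau$) such that $c_1\sqrt n\le t(n,\tau)\le c_2\sqrt n$ for all sufficiently large $n$.
   Context: A permutation is any finite sequence of distinct positive integers; an $n$-permutation is a permutation of $[n]=\{1,\dots,n\}$. Two permutations $(x_1,\dots,x_k)$ and $(y_1,\dots,y_k)$ are similar if $x_i<x_j \iff y_i<y_j$ for all $1\le i<j\le k$. A sub-permutation of $\pi$ is a subsequence of $\pi$. A permutation $\sigma$ avoids $\tau$ (is $\tau$-free) if no sub-permutation of $\sigma$ is similar to $\tau$. A pair of twins in $\pi$ is a pair of similar sub-permutations of $\pi$ with disjoint index sets; its length is the number of entries of one of them. A pair of twins $(\sigma_1,\sigma_2)$ is $\tau$-free if $\sigma_1$ (equivalently $\sigma_2$) avoids $\tau$. $t(\pi,\tau)$ is the maximum length of a pair of $\tau$-free twins in $\pi$, and $t(n,\tau)=\min\{t(\pi,\tau): \pi \text{ an } n\text{ -permutation}\}$. A permutation is monotone if it is increasing or decreasing. -}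

module Defs where

open import Data.Nat using (ℕ; suc; _<_; _>_)
open import Data.Fin as Fin using (Fin; cast)
open import Data.List using (List; length; map; lookup; upTo)
open import Data.List.Relation.Unary.All using (All)
open import Data.List.Relation.Unary.Linked using (Linked)
open import Data.List.Relation.Unary.Unique.Propositional using (Unique)
open import Data.List.Relation.Binary.Sublist.Propositional using (_⊆_)
open import Data.List.Relation.Binary.Permutation.Propositional using (_↭_)
open import Data.List.Membership.Propositional using (_∈_; _∉_)
open import Data.Product using (Σ; _×_)
open import Relation.Binary.PropositionalEquality using (_≡_)
open import Relation.Nullary using (¬_)
open import Function.Bundles using (_⇔_)

IsPermutation : List ℕ → Set
IsPermutation τ = Unique τ × All (0 <_) τ

IsNPerm : ℕ → List ℕ → Set
IsNPerm n π = π ↭ map suc (upTo n)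

Increasing Decreasing Monotone : List ℕ → Set
Increasing xs = Linked _<_ xs
Decreasing xs = Linked _>_ xs
Monotone xs = Increasing xs ⊎' Decreasing xs
  where
  open import Data.Sum renaming (_⊎_ to _⊎'_)

Similar : List ℕ → List ℕ → Set
Similar xs ys =
  Σ (length xs ≡ length ys) λ eq →
    ∀ (i j : Fin (length xs)) → i Fin.< j →
      (lookup xs i < lookup xs j) ⇔ (lookup ys (cast eq i) < lookup ys (cast eq j))

Avoids : List ℕ → List ℕ → Set
Avoids σ τ = ∀ ρ → ρ ⊆ σ → ¬ Similar ρ τ

pick : (π : List ℕ) → List (Fin (length π)) → List ℕ
pick π is = map (lookup π) is

record FreeTwins (π τ : List ℕ) (k : ℕ) : Set where
  field
    is js      : List (Fin (length π))
    is-incr    : Linked Fin._<_ is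
    js-incr    : Linked Fin._<_ js
    disjoint   : ∀ i → i ∈ is → i ∉ js
    len        : length is ≡ k
    similar    : Similar (pick π is) (pick π js)
    free       : Avoids (pick π is) τ

IsTwinMax : List ℕ → List ℕ → ℕ → Set
IsTwinMax π τ m = FreeTwins π τ m × (∀ k → FreeTwins π τ k → k Data.Nat.≤ m)
  where import Data.Nat

IsT : ℕ → List ℕ → ℕ → Set
IsT n τ m =
  Σ (List ℕ) (λ π → IsNPerm n π × IsTwinMax π τ m)
  × (∀ π m' → IsNPerm n π → IsTwinMax π τ m' → m Data.Nat.≤ m')
  where import Data.Nat

{-# OPTIONS --safe #-}
module Submission where

-- Lower bound: by Erdős–Szekeres an n-permutation has a monotone subsequence of length about √n,
-- whose two halves are monotone twins, hence τ-free.
--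
-- Upper bound: for k = ⌊√n⌋ take the permutation having exactly one point in every cell of a
-- k × k grid, extended by at most 2k further points.  Points whose cells lie in distinct rows and
-- columns are ordered as their cells are, so by the Marcus–Tardos theorem every τ-free
-- sub-permutation has O(k) points.

open import Defs
open import Data.Bool using (Bool; true; false; if_then_else_; not; _∧_; _∨_)
open import Data.Bool.Properties using (T-≡)
open import Data.Empty using (⊥; ⊥-elim)
open import Data.Nat
open import Data.Fin as Fin using (Fin; cast; toℕ; fromℕ<)
import Data.Fin.Properties as Fin
open import Data.List using (List; []; _∷_; _++_; length; map; lookup; tabulate; applyUpTo; upTo; allFin; concatMap)
open import Data.List.Extrema.Nat using (argmin; argmin-all; f[argmin]≤f[xs])
open import Data.List.Membership.DecPropositional _≟_ using (_∈?_)
open import Data.List.Membership.Propositional using (_∈_; _∉_; lose; find)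
open import Data.List.Membership.Propositional.Properties
open import Data.List.Membership.Propositional.Properties.WithK using (unique∧set⇒bag)
open import Data.List.Properties using (length-tabulate; length-map; map-tabulate; length-upTo; length-applyUpTo; lookup-applyUpTo; map-applyUpTo; lookup-tabulate; tabulate-lookup)
open import Data.List.Relation.Binary.BagAndSetEquality using (∼bag⇒↭)
open import Data.List.Relation.Binary.Permutation.Propositional using (_↭_; ↭⇒↭ₛ; ↭-refl; ↭-sym; ↭-trans; prep)
open import Data.List.Relation.Binary.Permutation.Propositional.Properties using (map⁺; ↭-length; drop-mid; ∈-resp-↭; shift; ↭-empty-inv)
import Data.List.Relation.Binary.Permutation.Setoid.Properties as PermutationSetoid
open import Data.List.Relation.Binary.Sublist.Heterogeneous.Properties using (length-mono-≤)
open import Data.List.Relation.Binary.Sublist.Propositional using (_⊆_; []; _∷ʳ_; _∷_; minimum)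
import Data.List.Relation.Binary.Sublist.Propositional.Properties as Sublist
open import Data.List.Relation.Unary.All as All using (All; []; _∷_)
open import Data.List.Relation.Unary.AllPairs as AllPairs using (AllPairs; []; _∷_)
import Data.List.Relation.Unary.AllPairs.Properties as AllPairs
open import Data.List.Relation.Unary.Any using (here; there; any?)
open import Data.List.Relation.Unary.Linked using (Linked; []; linked?)
open import Data.List.Relation.Unary.Linked.Properties using (Linked⇒AllPairs; AllPairs⇒Linked)
open import Data.List.Relation.Unary.Unique.Propositional using (Unique)
import Data.List.Relation.Unary.Unique.Propositional.Properties as Unique
open import Data.Nat.DivMod using (m≡m%n+[m/n]*n; m%n<n; m<n*o⇒m/o<n; [m+kn]%n≡m%n; m<n⇒m%n≡m; m<n⇒m/n≡0; m*n/n≡m; +-distrib-/-∣ˡ)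
open import Data.Nat.Divisibility using (n∣m*n)
open import Data.Nat.ListAction using (sum)
open import Data.Nat.Properties
open import Data.Nat.Tactic.RingSolver using (solve-∀)
open import Data.Product using (Σ; ∃; _×_; _,_; proj₁; proj₂)
open import Data.Sum using (_⊎_; inj₁; inj₂)
open import Function using (_∘_; id; flip)
open import Function.Bundles using (_⇔_; mk⇔; Equivalence)
open import Relation.Binary.PropositionalEquality
open import Relation.Nullary using (¬_; Dec; yes; no; does; ¬?)
open import Relation.Nullary.Decidable using (map′; dec-true; _×-dec_; _→-dec_)

-- Finite sums and counting

-- The cell (x , y) of the grid is entered at position `x * k + y` with value one more than
-- `y * k + x`. Both orders are lexicographic, so the leading coordinate decides whenever it
-- differs, while two points in a common row or column are compared by the other coordinate. This
-- tie-breaking does no harm, since the columns of a matrix occurrence follow the positions of τ and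
-- its rows follow the entries of τ, and both are pairwise distinct. The Marcus-Tardos argument runs
-- on an unbounded Boolean matrix whose sums are cut off at the required size. The forbidden pattern
-- is any family of points with bounded coordinates, so the entries of τ can be used directly,
-- without standardizing them to 1, ..., |τ|. Since t(n, τ) is given by a relation, its value has to
-- be exhibited: τ-free twins of a given length are decided by exhaustive search, maximized over
-- lengths and minimized over all permutations. Square roots never appear; both bounds compare n
-- with m * m.

∑ : ℕ → (ℕ → ℕ) → ℕ
∑ zero    f = 0
∑ (suc n) f = ∑ n f + f n

∑-mono : ∀ n {f g} → (∀ i → i < n → f i ≤ g i) → ∑ n f ≤ ∑ n g
∑-mono zero    h = z≤n
∑-mono (suc n) h = +-mono-≤ (∑-mono n (λ i i<n → h i (m<n⇒m<1+n i<n))) (h n (n<1+n n))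

∑-cong : ∀ n {f g} → (∀ i → f i ≡ g i) → ∑ n f ≡ ∑ n g
∑-cong zero    h = refl
∑-cong (suc n) h = cong₂ _+_ (∑-cong n h) (h n)

∑-+ : ∀ n f g → ∑ n (λ i → f i + g i) ≡ ∑ n f + ∑ n g
∑-+ zero    f g = refl
∑-+ (suc n) f g rewrite ∑-+ n f g = interchange (∑ n f) (∑ n g) (f n) (g n)
  where
  interchange : ∀ a b c d → a + b + (c + d) ≡ a + c + (b + d)
  interchange = solve-∀

∑-*ˡ : ∀ n c f → ∑ n (λ i → c * f i) ≡ c * ∑ n f
∑-*ˡ zero    c f = sym (*-zeroʳ c)
∑-*ˡ (suc n) c f rewrite ∑-*ˡ n c f = sym (*-distribˡ-+ c (∑ n f) (f n))

∑-*ʳ : ∀ n c f → ∑ n (λ i → f i * c) ≡ ∑ n f * c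
∑-*ʳ zero    c f = refl
∑-*ʳ (suc n) c f rewrite ∑-*ʳ n c f = sym (*-distribʳ-+ c (∑ n f) (f n))

∑-const : ∀ n c → ∑ n (λ _ → c) ≡ n * c
∑-const zero    c = refl
∑-const (suc n) c rewrite ∑-const n c = +-comm (n * c) c

∑-swap : ∀ m n (f : ℕ → ℕ → ℕ) → ∑ m (λ i → ∑ n (f i)) ≡ ∑ n (λ j → ∑ m (λ i → f i j))
∑-swap zero    n f = sym (trans (∑-const n 0) (*-zeroʳ n))
∑-swap (suc m) n f rewrite ∑-swap m n f = sym (∑-+ n (λ j → ∑ m (λ i → f i j)) (f m))

∑-split : ∀ m n f → ∑ (m + n) f ≡ ∑ m f + ∑ n (λ i → f (m + i))
∑-split m zero    f rewrite +-identityʳ m = sym (+-identityʳ (∑ m f))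
∑-split m (suc n) f rewrite +-suc m n | ∑-split m n f =
  +-assoc (∑ m f) (∑ n (λ i → f (m + i))) (f (m + n))

-- Serves twice: it cuts a matrix into square blocks of side s, and it reads the positions below
-- `k * k` as cells of the grid.
∑-blocks : ∀ m s f → ∑ (m * s) f ≡ ∑ m (λ X → ∑ s (λ x → f (X * s + x)))
∑-blocks zero    s f = refl
∑-blocks (suc m) s f rewrite +-comm s (m * s) | ∑-split (m * s) s f | ∑-blocks m s f = refl

∑-extend : ∀ {m n} f → m ≤ n → ∑ m f ≤ ∑ n f
∑-extend {m} {n} f m≤n = begin
  ∑ m f                                 ≤⟨ m≤m+n _ _ ⟩
  ∑ m f + ∑ (n ∸ m) (λ i → f (m + i))   ≡⟨ ∑-split m (n ∸ m) f ⟨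
  ∑ (m + (n ∸ m)) f                     ≡⟨ cong (λ k → ∑ k f) (m+[n∸m]≡n m≤n) ⟩
  ∑ n f                                 ∎
  where open ≤-Reasoning

∑≡0 : ∀ n f → (∀ i → i < n → f i ≤ 0) → ∑ n f ≤ 0
∑≡0 n f h = ≤-trans (∑-mono n h) (≤-reflexive (trans (∑-const n 0) (*-zeroʳ n)))

⟦_⟧ : Bool → ℕ
⟦ b ⟧ = if b then 1 else 0

⟦⟧≤1 : ∀ b → ⟦ b ⟧ ≤ 1
⟦⟧≤1 true  = ≤-refl
⟦⟧≤1 false = z≤n

count : (ℕ → Bool) → ℕ → ℕ
count p n = ∑ n (λ i → ⟦ p i ⟧)

count≤ : ∀ p n → count p n ≤ n
count≤ p n = ≤-trans (∑-mono n (λ i _ → ⟦⟧≤1 (p i))) (≤-reflexive (trans (∑-const n 1) (*-identityʳ n)))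

-- Bounded search, increasing enumerations and the pigeonhole principle.

some : ℕ → (ℕ → Bool) → Bool
some zero    p = false
some (suc n) p = some n p ∨ p n

some⁺ : ∀ {n p i} → i < n → p i ≡ true → some n p ≡ true
some⁺ {suc n} {p} {i} i<1+n pi with some n p in eq
... | true  = refl
... | false with i ≟ n
...   | yes refl = pi
...   | no i≢n with () ← trans (sym eq) (some⁺ {n} {p} (≤∧≢⇒< (s≤s⁻¹ i<1+n) i≢n) pi)

some⁻ : ∀ n {p} → some n p ≡ true → ∃ λ i → i < n × p i ≡ true
some⁻ (suc n) {p} h with some n p in eq
... | true  = let i , i<n , pi = some⁻ n eq in i , m<n⇒m<1+n i<n , pi
... | false = n , n<1+n n , h

-- The function `at` is total and its values from q on are arbitrary. Natural numbers such as
-- pattern coordinates can thus serve as indices directly, with bounds supplied only where they are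
-- needed.
record Chain (p : ℕ → Bool) (n q : ℕ) : Set where
  field
    at      : ℕ → ℕ
    bound   : ∀ {i} → i < q → at i < n
    holds   : ∀ {i} → i < q → p (at i) ≡ true
    at-mono : ∀ {i j} → i < j → j < q → at i < at j

chain : ∀ p n q → q ≤ count p n → Chain p n q
chain p n       zero    _ = record { at = λ _ → 0 ; bound = λ () ; holds = λ () ; at-mono = λ _ () }
chain p (suc n) (suc q) h with p n in eq
... | false = record
  { at = c.at ; bound = m<n⇒m<1+n ∘ c.bound ; holds = c.holds ; at-mono = c.at-mono }
  where
  module c = Chain (chain p n (suc q) (subst (suc q ≤_) (+-identityʳ _) h))
... | true = record { at = at ; bound = bound ; holds = holds ; at-mono = at-mono }
  where
  module c = Chain (chain p n q (s≤s⁻¹ (subst (suc q ≤_) (+-comm (count p n) 1) h)))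
  at : ℕ → ℕ
  at i with i <? q
  ... | yes _ = c.at i
  ... | no _  = n
  bound : ∀ {i} → i < suc q → at i < suc n
  bound {i} _ with i <? q
  ... | yes i<q = m<n⇒m<1+n (c.bound i<q)
  ... | no _    = n<1+n n
  holds : ∀ {i} → i < suc q → p (at i) ≡ true
  holds {i} _ with i <? q
  ... | yes i<q = c.holds i<q
  ... | no _    = eq
  at-mono : ∀ {i j} → i < j → j < suc q → at i < at j
  at-mono {i} {j} i<j j≤q with i <? q | j <? q
  ... | yes i<q | yes j<q = c.at-mono i<j j<q
  ... | yes i<q | no _    = c.bound i<q
  ... | no i≮q  | _       = ⊥-elim (i≮q (<-≤-trans i<j (s≤s⁻¹ j≤q)))

∧-trueˡ : ∀ a {b} → a ∧ b ≡ true → a ≡ true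
∧-trueˡ true _ = refl

∧-trueʳ : ∀ a {b} → a ∧ b ≡ true → b ≡ true
∧-trueʳ true h = h

not-true : ∀ {b} → not b ≡ true → b ≡ false
not-true {false} _ = refl

count-partition : ∀ (p g : ℕ → Bool) n → count p n ≡ count (λ i → p i ∧ g i) n + count (λ i → p i ∧ not (g i)) n
count-partition p g n =
  trans (∑-cong n (λ i → split (p i) (g i))) (∑-+ n (λ i → ⟦ p i ∧ g i ⟧) (λ i → ⟦ p i ∧ not (g i) ⟧))
  where
  split : ∀ a b → ⟦ a ⟧ ≡ ⟦ a ∧ b ⟧ + ⟦ a ∧ not b ⟧
  split true  true  = refl
  split true  false = refl
  split false _     = refl

-- The pigeonholes are the 2 ^ s possible restrictions of the rows `g i` to arguments below s;
-- `value` is the row shared by the whole part.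
record Uniform (g : ℕ → ℕ → Bool) (n k s : ℕ) (p : ℕ → Bool) : Set where
  field
    part    : ℕ → Bool
    large   : k < count part n
    part-⊆  : ∀ i → part i ≡ true → p i ≡ true
    value   : ℕ → Bool
    uniform : ∀ i {x} → part i ≡ true → x < s → g i x ≡ value x

uniform-suc : ∀ {g n k s p} (p₁ : ℕ → Bool) v → (∀ i → p₁ i ≡ true → p i ≡ true) →
  (∀ i → p₁ i ≡ true → g i s ≡ v) → Uniform g n k s p₁ → Uniform g n k (suc s) p
uniform-suc {g} {s = s} p₁ v p₁⊆p const u = record
  { part = part ; large = large ; part-⊆ = λ i → p₁⊆p i ∘ part-⊆ i ; value = value' ; uniform = uniform' }
  where
  open Uniform u
  value' : ℕ → Bool
  value' x with x ≟ s
  ... | yes _ = v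
  ... | no _  = value x
  uniform' : ∀ i {x} → part i ≡ true → x < suc s → g i x ≡ value' x
  uniform' i {x} pi x≤s with x ≟ s
  ... | yes refl = const i (part-⊆ i pi)
  ... | no x≢s   = uniform i pi (≤∧≢⇒< (s≤s⁻¹ x≤s) x≢s)

-- Halving the set once for each of the s coordinates.
pigeonhole : ∀ g n k s p → 2 ^ s * k < count p n → Uniform g n k s p
pigeonhole g n k zero p h = record
  { part = p ; large = subst (_< count p n) (+-identityʳ k) h ; part-⊆ = λ _ pi → pi
  ; value = λ _ → false ; uniform = λ _ _ () }
pigeonhole g n k (suc s) p h with 2 ^ s * k <? count (λ i → p i ∧ g i s) n
... | yes h₁ = uniform-suc (λ i → p i ∧ g i s) true
  (λ i → ∧-trueˡ (p i)) (λ i → ∧-trueʳ (p i)) (pigeonhole g n k s _ h₁)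
... | no h₁ = uniform-suc (λ i → p i ∧ not (g i s)) false
  (λ i → ∧-trueˡ (p i)) (λ i → not-true ∘ ∧-trueʳ (p i)) (pigeonhole g n k s _
    (+-cancelˡ-< K K _ (begin-strict
      K + K                  ≡⟨ double (2 ^ s) k ⟩
      2 ^ suc s * k          <⟨ h ⟩
      count p n              ≡⟨ count-partition p (λ i → g i s) n ⟩
      count (λ i → p i ∧ g i s) n + count (λ i → p i ∧ not (g i s)) n ≤⟨ +-monoˡ-≤ _ (≮⇒≥ h₁) ⟩
      K + count (λ i → p i ∧ not (g i s)) n ∎)))
    where
    open ≤-Reasoning
    K = 2 ^ s * k
    double : ∀ a k → a * k + a * k ≡ (2 * a) * k
    double = solve-∀

-- Marcus–Tardos

Matrix : Set
Matrix = ℕ → ℕ → Bool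

mass : ℕ → Matrix → ℕ
mass n S = ∑ n (λ x → ∑ n (λ y → ⟦ S x y ⟧))

-- A pattern is a family of points (a i , b i), and an occurrence of it only has to preserve the
-- strict comparisons of coordinates, which makes the notion symmetric under transposition.
record Contains {I : Set} (a b : I → ℕ) (S : Matrix) : Set where
  field
    x y    : I → ℕ
    x-mono : ∀ i j → a i < a j → x i < x j
    y-mono : ∀ i j → b i < b j → y i < y j
    in-S   : ∀ i → S (x i) (y i) ≡ true

transpose : ∀ {I : Set} {a b : I → ℕ} {S} → Contains b a (flip S) → Contains a b S
transpose c = record { x = y ; y = x ; x-mono = y-mono ; y-mono = x-mono ; in-S = in-S }
  where open Contains c

block-< : ∀ {s x} X X' x' → X < X' → x < s → X * s + x < X' * s + x'
block-< {s} {x} X X' x' X<X' x<s = begin-strict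
  X * s + x    <⟨ +-monoʳ-< (X * s) x<s ⟩
  X * s + s    ≡⟨ +-comm (X * s) s ⟩
  suc X * s    ≤⟨ *-monoˡ-≤ s X<X' ⟩
  X' * s       ≤⟨ m≤m+n _ x' ⟩
  X' * s + x'  ∎
  where open ≤-Reasoning

module Blocks (s : ℕ) where

  hasColumn : Matrix → ℕ → ℕ → ℕ → Bool
  hasColumn S X Y x = some s (λ y → S (X * s + x) (Y * s + y))

  contract : Matrix → Matrix
  contract S X Y = some s (hasColumn S X Y)

  wide : ℕ → Matrix → ℕ → ℕ → Bool
  wide q S X Y = q ≤ᵇ count (hasColumn S X Y) s

  tall : ℕ → Matrix → ℕ → ℕ → Bool
  tall q S X Y = wide q (flip S) Y X

  block : Matrix → ℕ → ℕ → ℕ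
  block S X Y = ∑ s (λ x → ∑ s (λ y → ⟦ S (X * s + x) (Y * s + y) ⟧))

  -- Any choice of one point in each occupied block works: coordinates that must increase strictly
  -- already do so at the level of blocks.
  contract-contains : ∀ {I : Set} {a b : I → ℕ} {S} → Contains a b (contract S) → Contains a b S
  contract-contains {I} {a} {b} {S} c = record
    { x = λ i → x i * s + col i
    ; y = λ i → y i * s + row i
    ; x-mono = λ i j ai<aj → block-< (x i) (x j) (col j) (x-mono i j ai<aj) (col-< i)
    ; y-mono = λ i j bi<bj → block-< (y i) (y j) (row j) (y-mono i j bi<bj) (row-< i)
    ; in-S = λ i → proj₂ (proj₂ (rows i))
    }
    where
    open Contains c
    cols : ∀ i → ∃ λ u → u < s × hasColumn S (x i) (y i) u ≡ true
    cols i = some⁻ s (in-S i)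
    col : I → ℕ
    col i = proj₁ (cols i)
    col-< : ∀ i → col i < s
    col-< i = proj₁ (proj₂ (cols i))
    rows : ∀ i → ∃ λ v → v < s × S (x i * s + col i) (y i * s + v) ≡ true
    rows i = some⁻ s (proj₂ (proj₂ (cols i)))
    row : I → ℕ
    row i = proj₁ (rows i)
    row-< : ∀ i → row i < s
    row-< i = proj₁ (proj₂ (rows i))

  -- More wide blocks in a column of blocks would give q of them sharing q nonempty columns.
  wide-bound : ∀ {I : Set} {a b : I → ℕ} {S} q X M → (∀ i → a i ≤ q) → (∀ i → b i ≤ q) →
    ¬ Contains a b S → count (wide (suc q) S X) M ≤ 2 ^ s * q
  wide-bound {I} {a} {b} {S} q X M a≤q b≤q avoid with 2 ^ s * q <? count (wide (suc q) S X) M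
  ... | no h  = ≮⇒≥ h
  ... | yes h = ⊥-elim (avoid (record
    { x = λ i → X * s + C.at (a i)
    ; y = λ i → B.at (b i) * s + row i
    ; x-mono = λ i j ai<aj → +-monoʳ-< (X * s) (C.at-mono ai<aj (s≤s (a≤q j)))
    ; y-mono = λ i j bi<bj →
        block-< (B.at (b i)) (B.at (b j)) (row j) (B.at-mono bi<bj (s≤s (b≤q j))) (row-< i)
    ; in-S = λ i → proj₂ (proj₂ (rows i))
    }))
    where
    -- Each block is classified by its set of nonempty columns, one of 2 ^ s subsets. The resulting
    -- q + 1 blocks with the same subset, and q + 1 columns in it, are exactly enough for pattern
    -- coordinates from 0 to q.
    open Uniform (pigeonhole (hasColumn S X) M q s (wide (suc q) S X) h)
    module B = Chain (chain part M (suc q) large)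
    Y₀ = B.at 0
    columns : suc q ≤ count (hasColumn S X Y₀) s
    columns = ≤ᵇ⇒≤ _ _ (Equivalence.from T-≡ (part-⊆ Y₀ (B.holds (s≤s z≤n))))
    module C = Chain (chain (hasColumn S X Y₀) s (suc q) columns)
    shared : ∀ i → hasColumn S X (B.at (b i)) (C.at (a i)) ≡ true
    shared i = begin
      hasColumn S X (B.at (b i)) (C.at (a i)) ≡⟨ uniform _ (B.holds (s≤s (b≤q i))) (C.bound (s≤s (a≤q i))) ⟩
      value (C.at (a i))                      ≡⟨ uniform _ (B.holds (s≤s z≤n)) (C.bound (s≤s (a≤q i))) ⟨
      hasColumn S X Y₀ (C.at (a i))           ≡⟨ C.holds (s≤s (a≤q i)) ⟩
      true                                    ∎
      where open ≡-Reasoning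
    rows : ∀ i → ∃ λ v → v < s × S (X * s + C.at (a i)) (B.at (b i) * s + v) ≡ true
    rows i = some⁻ s (shared i)
    row : I → ℕ
    row i = proj₁ (rows i)
    row-< : ∀ i → row i < s
    row-< i = proj₁ (proj₂ (rows i))

  -- Every point of a block lies in the product of its nonempty columns with its nonempty rows.
  block≤columns*rows : ∀ S X Y →
    block S X Y ≤ count (hasColumn S X Y) s * count (hasColumn (flip S) Y X) s
  block≤columns*rows S X Y = begin
    block S X Y
      ≤⟨ ∑-mono s (λ x x<s → ∑-mono s (λ y y<s → point x y x<s y<s)) ⟩
    ∑ s (λ x → ∑ s (λ y → ⟦ c x ⟧ * ⟦ r y ⟧))
      ≡⟨ ∑-cong s (λ x → ∑-*ˡ s ⟦ c x ⟧ (λ y → ⟦ r y ⟧)) ⟩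
    ∑ s (λ x → ⟦ c x ⟧ * count r s)
      ≡⟨ ∑-*ʳ s (count r s) (λ x → ⟦ c x ⟧) ⟩
    count c s * count r s ∎
    where
    open ≤-Reasoning
    c = hasColumn S X Y
    r = hasColumn (flip S) Y X
    point : ∀ x y → x < s → y < s → ⟦ S (X * s + x) (Y * s + y) ⟧ ≤ ⟦ c x ⟧ * ⟦ r y ⟧
    point x y x<s y<s with S (X * s + x) (Y * s + y) in eq
    ... | false = z≤n
    ... | true
      rewrite some⁺ {s} {λ v → S (X * s + x) (Y * s + v)} y<s eq
            | some⁺ {s} {λ u → S (X * s + u) (Y * s + y)} x<s eq = ≤-refl

  ¬contract⇒block≡0 : ∀ S X Y → contract S X Y ≡ false → block S X Y ≤ 0
  ¬contract⇒block≡0 S X Y empty = ∑≡0 s _ (λ x x<s → ∑≡0 s _ (λ y y<s → point x y x<s y<s))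
    where
    point : ∀ x y → x < s → y < s → ⟦ S (X * s + x) (Y * s + y) ⟧ ≤ 0
    point x y x<s y<s with S (X * s + x) (Y * s + y) in eq
    ... | false = z≤n
    ... | true with () ← trans (sym empty) (some⁺ {s} {hasColumn S X Y} x<s (some⁺ y<s eq))

  block≤s² : ∀ S X Y → block S X Y ≤ s * s
  block≤s² S X Y = ≤-trans (block≤columns*rows S X Y) (*-mono-≤ (count≤ _ s) (count≤ _ s))

  narrow : ∀ q S X Y → wide (suc q) S X Y ≡ false → count (hasColumn S X Y) s ≤ q
  narrow q S X Y eq with suc q ≤? count (hasColumn S X Y) s
  ... | no h  = s≤s⁻¹ (≰⇒> h)
  ... | yes h with () ← trans (sym eq) (Equivalence.to T-≡ (≤⇒≤ᵇ h))

  -- An empty block costs nothing. A block that is neither wide nor tall has at most q nonempty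
  -- columns and q nonempty rows, and a wide or tall one is charged its full area.
  block-bound : ∀ q S X Y → block S X Y ≤
    q * q * ⟦ contract S X Y ⟧ + s * s * (⟦ wide (suc q) S X Y ⟧ + ⟦ tall (suc q) S X Y ⟧)
  block-bound q S X Y with contract S X Y in eqc
  ... | false = ≤-trans (¬contract⇒block≡0 S X Y eqc) z≤n
  ... | true with wide (suc q) S X Y in eqw | tall (suc q) S X Y in eqt
  ...   | true  | t     = begin
    block S X Y        ≤⟨ block≤s² S X Y ⟩
    s * s              ≤⟨ m≤m*n (s * s) (suc ⟦ t ⟧) ⟩
    s * s * suc ⟦ t ⟧  ≤⟨ m≤n+m _ _ ⟩
    q * q * 1 + s * s * suc ⟦ t ⟧ ∎
    where open ≤-Reasoning
  ...   | false | true  = begin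
    block S X Y        ≤⟨ block≤s² S X Y ⟩
    s * s              ≡⟨ *-identityʳ (s * s) ⟨
    s * s * 1          ≤⟨ m≤n+m _ _ ⟩
    q * q * 1 + s * s * 1 ∎
    where open ≤-Reasoning
  ...   | false | false = begin
    block S X Y        ≤⟨ block≤columns*rows S X Y ⟩
    count (hasColumn S X Y) s * count (hasColumn (flip S) Y X) s
                       ≤⟨ *-mono-≤ (narrow q S X Y eqw) (narrow q (flip S) Y X eqt) ⟩
    q * q              ≡⟨ *-identityʳ (q * q) ⟨
    q * q * 1          ≤⟨ m≤m+n _ _ ⟩
    q * q * 1 + s * s * 0 ∎
    where open ≤-Reasoning

  mass-blocks : ∀ M S → mass (M * s) S ≡ ∑ M (λ X → ∑ M (λ Y → block S X Y))
  mass-blocks M S = begin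
    mass (M * s) S
      ≡⟨ ∑-blocks M s (λ x → ∑ (M * s) (λ y → ⟦ S x y ⟧)) ⟩
    ∑ M (λ X → ∑ s (λ x → ∑ (M * s) (λ y → ⟦ S (X * s + x) y ⟧)))
      ≡⟨ ∑-cong M (λ X → ∑-cong s (λ x → ∑-blocks M s (λ y → ⟦ S (X * s + x) y ⟧))) ⟩
    ∑ M (λ X → ∑ s (λ x → ∑ M (λ Y → ∑ s (λ y → ⟦ S (X * s + x) (Y * s + y) ⟧))))
      ≡⟨ ∑-cong M (λ X → ∑-swap s M (λ x Y → ∑ s (λ y → ⟦ S (X * s + x) (Y * s + y) ⟧))) ⟩
    ∑ M (λ X → ∑ M (λ Y → block S X Y)) ∎
    where open ≡-Reasoning

  -- The last double sum changes its order because wide blocks are bounded within each column of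
  -- blocks, but tall ones within each row.
  ∑∑-linear : ∀ M A B (f g h : ℕ → ℕ → ℕ) →
    ∑ M (λ X → ∑ M (λ Y → A * f X Y + B * (g X Y + h X Y))) ≡
    A * ∑ M (λ X → ∑ M (f X)) + B * (∑ M (λ X → ∑ M (g X)) + ∑ M (λ Y → ∑ M (λ X → h X Y)))
  ∑∑-linear M A B f g h rewrite ∑-swap M M (λ Y X → h X Y) =
    trans (∑-cong M (λ X → linear (f X) (g X) (h X)))
      (linear (λ X → ∑ M (f X)) (λ X → ∑ M (g X)) (λ X → ∑ M (h X)))
    where
    linear : ∀ f g h → ∑ M (λ Y → A * f Y + B * (g Y + h Y)) ≡ A * ∑ M f + B * (∑ M g + ∑ M h)
    linear f g h
      rewrite ∑-+ M (λ Y → A * f Y) (λ Y → B * (g Y + h Y)) | ∑-*ˡ M A f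
            | ∑-*ˡ M B (λ Y → g Y + h Y) | ∑-+ M g h = refl

  mass-step : ∀ {I : Set} {a b : I → ℕ} {S} q M → (∀ i → a i ≤ q) → (∀ i → b i ≤ q) →
    ¬ Contains a b S →
    mass (M * s) S ≤ q * q * mass M (contract S) + s * s * (M * (2 ^ s * q) + M * (2 ^ s * q))
  mass-step {S = S} q M a≤q b≤q avoid = begin
    mass (M * s) S
      ≡⟨ mass-blocks M S ⟩
    ∑ M (λ X → ∑ M (λ Y → block S X Y))
      ≤⟨ ∑-mono M (λ X _ → ∑-mono M (λ Y _ → block-bound q S X Y)) ⟩
    ∑ M (λ X → ∑ M (λ Y →
      q * q * ⟦ contract S X Y ⟧ + s * s * (⟦ wide (suc q) S X Y ⟧ + ⟦ tall (suc q) S X Y ⟧)))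
      ≡⟨ ∑∑-linear M (q * q) (s * s) (λ X Y → ⟦ contract S X Y ⟧)
           (λ X Y → ⟦ wide (suc q) S X Y ⟧) (λ X Y → ⟦ tall (suc q) S X Y ⟧) ⟩
    q * q * mass M (contract S) +
      s * s * (∑ M (λ X → count (wide (suc q) S X) M) + ∑ M (λ Y → count (wide (suc q) (flip S) Y) M))
      ≤⟨ +-monoʳ-≤ (q * q * mass M (contract S)) (*-monoʳ-≤ (s * s) (+-mono-≤
           (line S (λ X → wide-bound q X M a≤q b≤q avoid))
           (line (flip S) (λ Y → wide-bound q Y M b≤q a≤q (avoid ∘ transpose))))) ⟩
    q * q * mass M (contract S) + s * s * (M * (2 ^ s * q) + M * (2 ^ s * q)) ∎
    where
    open ≤-Reasoning
    line : ∀ S → (∀ X → count (wide (suc q) S X) M ≤ 2 ^ s * q) →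
      ∑ M (λ X → count (wide (suc q) S X) M) ≤ M * (2 ^ s * q)
    line S h = ≤-trans (∑-mono M (λ X _ → h X)) (≤-reflexive (∑-const M _))

-- With s = q² + 1 the recurrence f (s M) ≤ q² f M + D M is solved by f M = (D + 1) M.
blockSize mtConstant : ℕ → ℕ
blockSize q = suc (q * q)
mtConstant q = suc (s * s * (2 * (2 ^ s * q)))
  where s = blockSize q

marcus-tardos-power : ∀ {I : Set} {a b : I → ℕ} q → (∀ i → a i ≤ q) → (∀ i → b i ≤ q) →
  ∀ m S → ¬ Contains a b S → mass (blockSize q ^ m) S ≤ mtConstant q * blockSize q ^ m
marcus-tardos-power q a≤q b≤q zero S avoid =
  ≤-trans (⟦⟧≤1 (S 0 0)) (s≤s z≤n)
marcus-tardos-power q a≤q b≤q (suc m) S avoid = begin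
  mass (s * M) S
    ≡⟨ cong (λ N → mass N S) (*-comm s M) ⟩
  mass (M * s) S
    ≤⟨ mass-step q M a≤q b≤q avoid ⟩
  q * q * mass M (contract S) + s * s * (M * K + M * K)
    ≤⟨ +-monoˡ-≤ _ (*-monoʳ-≤ (q * q)
         (marcus-tardos-power q a≤q b≤q m (contract S) (avoid ∘ contract-contains))) ⟩
  q * q * (mtConstant q * M) + s * s * (M * K + M * K)
    -- The added M completes the q² copies coming from the `suc` in `mtConstant` to q² + 1 copies,
    -- so that the next step is an identity. The same `suc` covers the base case of a single entry.
    ≤⟨ m≤n+m _ M ⟩
  M + (q * q * (mtConstant q * M) + s * s * (M * K + M * K))
    ≡⟨ rearrange q (s * s) K M ⟩
  mtConstant q * (s * M) ∎
  where
  open ≤-Reasoning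
  s = blockSize q
  open Blocks s
  M = s ^ m
  K = 2 ^ s * q
  rearrange : ∀ q t K M → M + (q * q * (suc (t * (2 * K)) * M) + t * (M * K + M * K)) ≡
    suc (t * (2 * K)) * (suc (q * q) * M)
  rearrange = solve-∀

mass-mono : ∀ {m n} S → m ≤ n → mass m S ≤ mass n S
mass-mono {m} {n} S m≤n =
  ≤-trans (∑-mono m (λ x _ → ∑-extend (λ y → ⟦ S x y ⟧) m≤n)) (∑-extend _ m≤n)

-- The recurrence reaches only powers of the block size; rounding up to one costs a further factor
-- s, which is the factor `blockSize q` in `marcus-tardos`.
next-power : ∀ s k → 2 ≤ s → ∃ λ m → suc k ≤ s ^ m × s ^ m ≤ s * suc k
next-power s zero    2≤s = 0 , s≤s z≤n , ≤-trans (<⇒≤ 2≤s) (≤-reflexive (sym (*-identityʳ s)))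
next-power s (suc k) 2≤s with next-power s k 2≤s
... | m , k<sᵐ , sᵐ≤sk with suc (suc k) ≤? s ^ m
...   | yes h = m , h , ≤-trans sᵐ≤sk (*-monoʳ-≤ s (n≤1+n _))
...   | no h  = suc m , lower , *-monoʳ-≤ s (<⇒≤ (≰⇒> h))
  where
  open ≤-Reasoning
  lower : suc (suc k) ≤ s * s ^ m
  lower = begin
    suc (suc k)        ≤⟨ m≤n+m _ k ⟩
    k + suc (suc k)    ≡⟨ double k ⟩
    2 * suc k          ≤⟨ *-mono-≤ 2≤s k<sᵐ ⟩
    s * s ^ m          ∎
    where
    double : ∀ k → k + suc (suc k) ≡ 2 * suc k
    double = solve-∀

marcus-tardos : ∀ {I : Set} {a b : I → ℕ} q → 1 ≤ q → (∀ i → a i ≤ q) → (∀ i → b i ≤ q) →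
  ∀ k S → ¬ Contains a b S → mass k S ≤ mtConstant q * blockSize q * k
marcus-tardos q 1≤q a≤q b≤q zero    S avoid = z≤n
marcus-tardos q 1≤q a≤q b≤q (suc k) S avoid
  with next-power (blockSize q) k (s≤s (*-mono-≤ 1≤q 1≤q))
... | m , k<sᵐ , sᵐ≤sk = begin
  mass (suc k) S                       ≤⟨ mass-mono S k<sᵐ ⟩
  mass (blockSize q ^ m) S             ≤⟨ marcus-tardos-power q a≤q b≤q m S avoid ⟩
  mtConstant q * blockSize q ^ m       ≤⟨ *-monoʳ-≤ (mtConstant q) sᵐ≤sk ⟩
  mtConstant q * (blockSize q * suc k) ≡⟨ *-assoc (mtConstant q) (blockSize q) (suc k) ⟨
  mtConstant q * blockSize q * suc k   ∎
  where open ≤-Reasoning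

-- Existence of t(n, τ)

module _ {A : Set} where

  sublists : List A → List (List A)
  sublists []       = [] ∷ []
  sublists (x ∷ xs) = sublists xs ++ map (x ∷_) (sublists xs)

  ∈-sublists⁺ : ∀ {ρ xs : List A} → ρ ⊆ xs → ρ ∈ sublists xs
  ∈-sublists⁺ []         = here refl
  ∈-sublists⁺ (x ∷ʳ ρ⊆)  = ∈-++⁺ˡ (∈-sublists⁺ ρ⊆)
  ∈-sublists⁺ {xs = x ∷ xs} (refl ∷ ρ⊆) = ∈-++⁺ʳ (sublists xs) (∈-map⁺ (x ∷_) (∈-sublists⁺ ρ⊆))

  ∈-sublists⁻ : ∀ {ρ} (xs : List A) → ρ ∈ sublists xs → ρ ⊆ xs
  ∈-sublists⁻ []       (here refl) = []
  ∈-sublists⁻ (x ∷ xs) ρ∈ with ∈-++⁻ (sublists xs) ρ∈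
  ... | inj₁ ρ∈ˡ = x ∷ʳ ∈-sublists⁻ xs ρ∈ˡ
  ... | inj₂ ρ∈ʳ with ∈-map⁻ (x ∷_) ρ∈ʳ
  ...   | ρ' , ρ'∈ , refl = refl ∷ ∈-sublists⁻ xs ρ'∈

  any-sublist? : ∀ {P : List A → Set} → (∀ ρ → Dec (P ρ)) → ∀ xs → Dec (∃ λ ρ → ρ ⊆ xs × P ρ)
  any-sublist? P? xs = map′
    (λ any → let ρ , ρ∈ , pρ = find any in ρ , ∈-sublists⁻ xs ρ∈ , pρ)
    (λ (ρ , ρ⊆ , pρ) → lose (∈-sublists⁺ ρ⊆) pρ)
    (any? P? (sublists xs))

  insertions : A → List A → List (List A)
  insertions x []       = (x ∷ []) ∷ []
  insertions x (y ∷ ys) = (x ∷ y ∷ ys) ∷ map (y ∷_) (insertions x ys)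

  ∈-insertions⁺ : ∀ x ys zs → ys ++ x ∷ zs ∈ insertions x (ys ++ zs)
  ∈-insertions⁺ x []       []       = here refl
  ∈-insertions⁺ x []       (z ∷ zs) = here refl
  ∈-insertions⁺ x (y ∷ ys) zs       = there (∈-map⁺ (y ∷_) (∈-insertions⁺ x ys zs))

  ∈-insertions⁻ : ∀ {zs} x ys → zs ∈ insertions x ys → zs ↭ x ∷ ys
  ∈-insertions⁻ x []       (here refl) = ↭-refl
  ∈-insertions⁻ x (y ∷ ys) (here refl) = ↭-refl
  ∈-insertions⁻ x (y ∷ ys) (there zs∈) with ∈-map⁻ (y ∷_) zs∈
  ... | zs' , zs'∈ , refl = ↭-trans (prep y (∈-insertions⁻ x ys zs'∈)) (shift x (y ∷ []) ys)

  permutations : List A → List (List A)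
  permutations []       = [] ∷ []
  permutations (x ∷ xs) = concatMap (insertions x) (permutations xs)

  -- Deleting an occurrence of x from ys leaves a permutation of xs, and ys is recovered by
  -- inserting x at the same place.
  ∈-permutations⁺ : ∀ {ys} xs → ys ↭ xs → ys ∈ permutations xs
  ∈-permutations⁺ []       ys↭ rewrite ↭-empty-inv ys↭ = here refl
  ∈-permutations⁺ (x ∷ xs) ys↭ with ∈-∃++ (∈-resp-↭ (↭-sym ys↭) (here refl))
  ... | us , vs , refl = ∈-concatMap⁺ (insertions x)
    (lose (∈-permutations⁺ xs (drop-mid us [] ys↭)) (∈-insertions⁺ x us vs))

  ∈-permutations⁻ : ∀ {ys} xs → ys ∈ permutations xs → ys ↭ xs
  ∈-permutations⁻ []       (here refl) = ↭-refl
  ∈-permutations⁻ (x ∷ xs) ys∈ with find (∈-concatMap⁻ (insertions x) {xs = permutations xs} ys∈)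
  ... | zs , zs∈ , ys∈' = ↭-trans (∈-insertions⁻ x zs ys∈') (prep x (∈-permutations⁻ xs zs∈))

-- Deciding twins and finding the extremal values.

-- If the two heads differ, the head of js is below every element of is and can be skipped. This
-- makes the search for index lists finite, and later turns a set of chosen cells into a
-- sub-permutation.
sorted-⊆ : ∀ {n} {is js : List (Fin n)} → AllPairs Fin._<_ is → AllPairs Fin._<_ js →
  (∀ {i} → i ∈ is → i ∈ js) → is ⊆ js
sorted-⊆ {js = js} [] js↗ sub = minimum js
sorted-⊆ {js = []} (_ ∷ _) js↗ sub with () ← sub (here refl)
sorted-⊆ {is = i ∷ is} {js = j ∷ js} (i< ∷ is↗) (j< ∷ js↗) sub with sub (here refl)
... | here refl = refl ∷ sorted-⊆ is↗ js↗ sub'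
  where
  sub' : ∀ {z} → z ∈ is → z ∈ js
  sub' z∈is with sub (there z∈is)
  ... | here refl  = ⊥-elim (<-irrefl refl (All.lookup i< z∈is))
  ... | there z∈js = z∈js
... | there i∈js = j ∷ʳ sorted-⊆ (i< ∷ is↗) js↗ sub'
  where
  j<i = All.lookup j< i∈js
  sub' : ∀ {z} → z ∈ i ∷ is → z ∈ js
  sub' z∈ with sub z∈
  ... | there z∈js = z∈js
  sub' (here refl)  | here refl = ⊥-elim (<-irrefl refl j<i)
  sub' (there z∈is) | here refl = ⊥-elim (<-irrefl refl (<-trans j<i (All.lookup i< z∈is)))

increasing-⊆-allFin : ∀ {n} {is : List (Fin n)} → Linked Fin._<_ is → is ⊆ allFin n
increasing-⊆-allFin is↗ = sorted-⊆ (Linked⇒AllPairs Fin.<-trans is↗) (AllPairs.tabulate⁺-< id)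
  (λ _ → ∈-allFin _)

_⇔-dec_ : ∀ {A B : Set} → Dec A → Dec B → Dec (A ⇔ B)
a? ⇔-dec b? = map′ (λ (f , g) → mk⇔ f g) (λ e → Equivalence.to e , Equivalence.from e)
  ((a? →-dec b?) ×-dec (b? →-dec a?))

similar? : ∀ xs ys → Dec (Similar xs ys)
similar? xs ys with length xs ≟ length ys
... | no ≢   = no (≢ ∘ proj₁)
... | yes eq = map′ (eq ,_) proj₂
  (Fin.all? λ i → Fin.all? λ j → (i Fin.<? j) →-dec
    ((lookup xs i <? lookup xs j) ⇔-dec (lookup ys (cast eq i) <? lookup ys (cast eq j))))

avoids? : ∀ σ τ → Dec (Avoids σ τ)
avoids? σ τ = map′ (λ none ρ ρ⊆σ sim → none (ρ , ρ⊆σ , sim)) (λ av (ρ , ρ⊆σ , sim) → av ρ ρ⊆σ sim)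
  (¬? (any-sublist? (λ ρ → similar? ρ τ) σ))

freeTwins? : ∀ π τ k → Dec (FreeTwins π τ k)
freeTwins? π τ k = map′ build split
  (any-sublist? (λ is → any-sublist? (λ js →
    linked? Fin._<?_ is ×-dec linked? Fin._<?_ js ×-dec All.all? (λ i → ¬? (i ∈ᶠ? js)) is ×-dec
    (length is ≟ k) ×-dec similar? (pick π is) (pick π js) ×-dec avoids? (pick π is) τ)
    (allFin _)) (allFin _))
  where
  open import Data.List.Membership.DecPropositional Fin._≟_ using () renaming (_∈?_ to _∈ᶠ?_)
  build : _ → FreeTwins π τ k
  build (is , _ , js , _ , is↗ , js↗ , disj , len , sim , free) = record
    { is = is ; js = js ; is-incr = is↗ ; js-incr = js↗
    ; disjoint = λ i → All.lookup disj ; len = len ; similar = sim ; free = free }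
  split : FreeTwins π τ k → _
  split t = is , increasing-⊆-allFin is-incr , js , increasing-⊆-allFin js-incr ,
    is-incr , js-incr , All.tabulate (disjoint _) , len , similar , free
    where open FreeTwins t

freeTwins-≤ : ∀ {π τ k} → FreeTwins π τ k → k ≤ length π
freeTwins-≤ t = subst₂ _≤_ len (length-tabulate id) (length-mono-≤ (increasing-⊆-allFin is-incr))
  where open FreeTwins t

maximum : ∀ {P : ℕ → Set} → (∀ k → Dec (P k)) → P 0 → ∀ B → (∀ k → P k → k ≤ B) →
  ∃ λ m → P m × (∀ k → P k → k ≤ m)
maximum P? p0 zero    P≤B = 0 , p0 , P≤B
maximum P? p0 (suc B) P≤B with P? (suc B)
... | yes pB = suc B , pB , P≤B
... | no ¬pB = maximum P? p0 B λ k pk →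
  s≤s⁻¹ (≤∧≢⇒< (P≤B k pk) (λ where refl → ¬pB pk))

twinMax : ∀ τ → (∀ π → FreeTwins π τ 0) → ∀ π → ∃ λ m → IsTwinMax π τ m
twinMax τ empty π = maximum (freeTwins? π τ) (empty π) (length π) (λ _ → freeTwins-≤)

isT-exists : ∀ τ → (∀ π → FreeTwins π τ 0) → ∀ n → ∃ λ m → IsT n τ m
isT-exists τ empty n =
  t best ,
  (best , argmin-all t ↭-refl (All.tabulate (∈-permutations⁻ base)) , proj₂ (twinMax τ empty best)) ,
  λ π m' π↭ (tw , max) → ≤-trans
    (All.lookup (f[argmin]≤f[xs] base (permutations base)) (∈-permutations⁺ base π↭))
    (max _ (proj₁ (proj₂ (twinMax τ empty π))))
  where
  base = map suc (upTo n)
  t : List ℕ → ℕ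
  t π = proj₁ (twinMax τ empty π)
  -- The first `base` is the default candidate; it is a permutation of itself, so the minimizer is
  -- always admissible.
  best = argmin t base (permutations base)

-- Monotone twins

module _ {A : Set} {R : A → A → Set} where

  AllPairs-lookup : ∀ {xs} → AllPairs R xs → ∀ i j → i Fin.< j → R (lookup xs i) (lookup xs j)
  AllPairs-lookup (Rx ∷ _)  Fin.zero    (Fin.suc j) _   = All.lookup Rx (∈-lookup j)
  AllPairs-lookup (_ ∷ Rxs) (Fin.suc i) (Fin.suc j) i<j = AllPairs-lookup Rxs i j (s≤s⁻¹ i<j)

  lookup-AllPairs : ∀ xs → (∀ i j → i Fin.< j → R (lookup xs i) (lookup xs j)) → AllPairs R xs
  lookup-AllPairs xs h = subst (AllPairs R) (tabulate-lookup xs) (AllPairs.tabulate⁺-< (h _ _))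

  AllPairs-resp-⊆ : ∀ {xs ys} → xs ⊆ ys → AllPairs R ys → AllPairs R xs
  AllPairs-resp-⊆ []            _          = []
  AllPairs-resp-⊆ (_ ∷ʳ xs⊆)    (_ ∷ Rys)  = AllPairs-resp-⊆ xs⊆ Rys
  AllPairs-resp-⊆ (refl ∷ xs⊆)  (Ry ∷ Rys) = Sublist.All-resp-⊆ xs⊆ Ry ∷ AllPairs-resp-⊆ xs⊆ Rys

cast-mono-< : ∀ {m n} .(eq : m ≡ n) (i j : Fin m) → i Fin.< j → cast eq i Fin.< cast eq j
cast-mono-< eq i j = subst₂ _<_ (sym (Fin.toℕ-cast eq i)) (sym (Fin.toℕ-cast eq j))

-- What the twin construction needs from `_<_` or `_>_`: `similar` makes two monotone halves twins,
-- and `inherits` makes them τ-free, as a copy of τ inside them would force τ itself to be monotone.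
record Direction (R : ℕ → ℕ → Set) (τ : List ℕ) : Set₁ where
  field
    similar  : ∀ {xs ys} → AllPairs R xs → AllPairs R ys → length xs ≡ length ys → Similar xs ys
    inherits : ∀ {ρ} → Similar ρ τ → AllPairs R ρ → AllPairs R τ

similar-transfer : ∀ {R : ℕ → ℕ → Set} {ρ τ} ((eq , _) : Similar ρ τ) →
  (∀ i j → i Fin.< j → R (lookup τ (cast eq i)) (lookup τ (cast eq j))) → AllPairs R τ
similar-transfer {R} {ρ} {τ} (eq , _) h = lookup-AllPairs τ λ i j i<j →
  subst₂ (λ i j → R (lookup τ i) (lookup τ j))
    (Fin.cast-involutive eq (sym eq) i) (Fin.cast-involutive eq (sym eq) j)
    (h (cast (sym eq) i) (cast (sym eq) j) (cast-mono-< (sym eq) i j i<j))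

increasing : ∀ τ → Direction _<_ τ
increasing τ = record
  { similar = λ xs↗ ys↗ eq → eq , λ i j i<j → mk⇔
      (λ _ → AllPairs-lookup ys↗ _ _ (cast-mono-< eq i j i<j)) (λ _ → AllPairs-lookup xs↗ i j i<j)
  ; inherits = λ {ρ} sim ρ↗ → similar-transfer {ρ = ρ} sim λ i j i<j →
      Equivalence.to (proj₂ sim i j i<j) (AllPairs-lookup ρ↗ i j i<j)
  }

-- Similarity speaks only of `_<_`, so a descent in ρ yields merely a non-ascent in τ; distinctness
-- of the entries of τ makes it strict.
decreasing : ∀ τ → Unique τ → Direction _>_ τ
decreasing τ τ! = record
  { similar = λ xs↘ ys↘ eq → eq , λ i j i<j → mk⇔
      (λ lt → ⊥-elim (<-asym lt (AllPairs-lookup xs↘ i j i<j)))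
      (λ lt → ⊥-elim (<-asym lt (AllPairs-lookup ys↘ _ _ (cast-mono-< eq i j i<j))))
  ; inherits = λ {ρ} sim ρ↘ → similar-transfer {ρ = ρ} sim λ i j i<j →
      ≤∧≢⇒< (≮⇒≥ (λ lt → <-asym (Equivalence.from (proj₂ sim i j i<j) lt) (AllPairs-lookup ρ↘ i j i<j)))
            (≢-sym (AllPairs-lookup τ! _ _ (cast-mono-< (proj₁ sim) i j i<j)))
  }

prepend : ∀ {p n q j} (c : Chain p n (suc q)) → j < Chain.at c 0 → p j ≡ true → Chain p n (suc (suc q))
prepend {p} {n} {q} {j} c j<c pj = record
  { at = at' ; bound = bound' ; holds = holds' ; at-mono = at-mono' }
  where
  open Chain c
  at' : ℕ → ℕ
  at' zero    = j
  at' (suc i) = at i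
  bound' : ∀ {i} → i < suc (suc q) → at' i < n
  bound' {zero}  _ = <-trans j<c (bound z<s)
  bound' {suc i} i< = bound (s≤s⁻¹ i<)
  holds' : ∀ {i} → i < suc (suc q) → p (at' i) ≡ true
  holds' {zero}  _ = pj
  holds' {suc i} i< = holds (s≤s⁻¹ i<)
  at-mono' : ∀ {i k} → i < k → k < suc (suc q) → at' i < at' k
  at-mono' {zero}  {suc zero}    _   _  = j<c
  at-mono' {zero}  {suc (suc k)} _   k< = <-trans j<c (at-mono z<s (s≤s⁻¹ k<))
  at-mono' {suc i} {suc k}       i<k k< = at-mono (s≤s⁻¹ i<k) (s≤s⁻¹ k<)

weaken : ∀ {p p' n q} → (∀ i → p i ≡ true → p' i ≡ true) → Chain p n q → Chain p' n q
weaken p⊆p' c = record { at = at ; bound = bound ; holds = p⊆p' _ ∘ holds ; at-mono = at-mono }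
  where open Chain c

Ordered : (ℕ → ℕ → Set) → (ℕ → ℕ) → ∀ {p n q} → Chain p n q → Set
Ordered R v {q = q} c = ∀ {i j} → i < j → j < q → R (v (Chain.at c i)) (v (Chain.at c j))

-- The left-to-right minima form a decreasing sequence, and every other element can be preceded
-- by a smaller one.
erdős-szekeres : ∀ v n → (∀ {i j} → i < j → j < n → v i ≢ v j) → ∀ a b p → a * b < count p n →
  (Σ (Chain p n (suc a)) (Ordered _<_ v)) ⊎ (Σ (Chain p n (suc b)) (Ordered _>_ v))
erdős-szekeres v n inj zero b p h =
  inj₁ (chain p n 1 h , λ i<j j<1 → ⊥-elim (n≮0 (<-≤-trans i<j (s≤s⁻¹ j<1))))
erdős-szekeres v n inj (suc a) b p h = split (b <? count (λ i → p i ∧ not (undercut i)) n)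
  where
  -- An element of p that is not undercut is a left-to-right minimum within p.
  undercut : ℕ → Bool
  undercut i = some i (λ j → p j ∧ (v j <ᵇ v i))
  minima : Chain (λ i → p i ∧ not (undercut i)) n (suc b) → Σ (Chain p n (suc b)) (Ordered _>_ v)
  minima c = weaken (λ i → ∧-trueˡ (p i)) c , λ {i} {j} i<j j≤b →
    ≤∧≢⇒< (≮⇒≥ λ vᵢ<vⱼ → contra (not-true (∧-trueʳ (p (at j)) (holds j≤b)))
      (some⁺ (at-mono i<j j≤b) (∧-true (∧-trueˡ (p (at i)) (holds (<-trans i<j j≤b)))
        (Equivalence.to T-≡ (<⇒<ᵇ vᵢ<vⱼ)))))
      (≢-sym (inj (at-mono i<j j≤b) (bound j≤b)))
    where
    open Chain c
    contra : ∀ {b} → b ≡ false → ¬ b ≡ true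
    contra refl ()
    ∧-true : ∀ {a b} → a ≡ true → b ≡ true → a ∧ b ≡ true
    ∧-true refl refl = refl
  extend : Σ (Chain (λ i → p i ∧ undercut i) n (suc a)) (Ordered _<_ v) →
    Σ (Chain p n (suc (suc a))) (Ordered _<_ v)
  extend (c , ord) with some⁻ (Chain.at c 0) (∧-trueʳ (p (Chain.at c 0)) (Chain.holds c z<s))
  ... | j , j<c , eq = prepend (weaken (λ i → ∧-trueˡ (p i)) c) j<c (∧-trueˡ (p j) eq) , ord'
    where
    vⱼ<v₀ : v j < v (Chain.at c 0)
    vⱼ<v₀ = <ᵇ⇒< _ _ (Equivalence.from T-≡ (∧-trueʳ (p j) eq))
    ord' : Ordered _<_ v (prepend (weaken (λ i → ∧-trueˡ (p i)) c) j<c (∧-trueˡ (p j) eq))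
    ord' {zero}  {suc zero}    _   _  = vⱼ<v₀
    ord' {zero}  {suc (suc k)} _   k< = <-trans vⱼ<v₀ (ord z<s (s≤s⁻¹ k<))
    ord' {suc i} {suc k}       i<k k< = ord (s≤s⁻¹ i<k) (s≤s⁻¹ k<)
  split : _ → _
  split (yes h₁) = inj₂ (minima (chain _ n (suc b) h₁))
  -- At most b elements are minima, so more than `a * b` undercut ones remain. A rising chain among
  -- them starts at an undercut element and is lengthened by the element of p that undercuts it.
  split (no h₁) with erdős-szekeres v n inj a b (λ i → p i ∧ undercut i)
    (+-cancelˡ-< b _ _ (begin-strict
      b + a * b ≡⟨⟩
      suc a * b <⟨ h ⟩
      count p n ≡⟨ count-partition p undercut n ⟩
      count (λ i → p i ∧ undercut i) n + count (λ i → p i ∧ not (undercut i)) n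
        ≤⟨ +-monoʳ-≤ _ (≮⇒≥ h₁) ⟩
      count (λ i → p i ∧ undercut i) n + b ≡⟨ +-comm _ b ⟩
      b + count (λ i → p i ∧ undercut i) n ∎))
    where open ≤-Reasoning
  ... | inj₁ c         = inj₁ (extend c)
  ... | inj₂ (c , ord) = inj₂ (weaken (λ i → ∧-trueˡ (p i)) c , ord)

-- Cutting a monotone chain into twins.

-- A total lookup with junk value 0 past the end, matching the natural-number indices of
-- `erdős-szekeres`.
valueAt : List ℕ → ℕ → ℕ
valueAt []      _       = 0
valueAt (x ∷ π) zero    = x
valueAt (x ∷ π) (suc i) = valueAt π i

lookup≡valueAt : ∀ π i → lookup π i ≡ valueAt π (toℕ i)
lookup≡valueAt (x ∷ π) Fin.zero    = refl
lookup≡valueAt (x ∷ π) (Fin.suc i) = lookup≡valueAt π i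

valueAt-injective : ∀ {π} → Unique π → ∀ {i j} → i < j → j < length π → valueAt π i ≢ valueAt π j
valueAt-injective {π} π! {i} {j} i<j j<n eq = AllPairs-lookup π! (fromℕ< i<n) (fromℕ< j<n)
  (subst₂ _<_ (sym (Fin.toℕ-fromℕ< i<n)) (sym (Fin.toℕ-fromℕ< j<n)) i<j)
  (trans (at i<n) (trans eq (sym (at j<n))))
  where
  i<n = <-trans i<j j<n
  at : ∀ {k} (k<n : k < length π) → lookup π (fromℕ< k<n) ≡ valueAt π k
  at k<n = trans (lookup≡valueAt π _) (cong (valueAt π) (Fin.toℕ-fromℕ< k<n))

module Segments {n q p} (c : Chain p n q) where
  open Chain c

  offset-< : ∀ {o h} → o + h ≤ q → (t : Fin h) → o + toℕ t < q
  offset-< {o} o+h≤q t = <-≤-trans (+-monoʳ-< o (Fin.toℕ<n t)) o+h≤q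

  index : ∀ o {h} → o + h ≤ q → Fin h → Fin n
  index o {h} b t = fromℕ< (bound {o + toℕ t} (offset-< {o} {h} b t))

  toℕ-index : ∀ o {h} (b : o + h ≤ q) (t : Fin h) → toℕ (index o b t) ≡ at (o + toℕ t)
  toℕ-index o {h} b t = Fin.toℕ-fromℕ< (bound {o + toℕ t} (offset-< {o} {h} b t))

  segment : ∀ o {h} → o + h ≤ q → List (Fin n)
  segment o b = tabulate (index o b)

  length-segment : ∀ o {h} (b : o + h ≤ q) → length (segment o b) ≡ h
  length-segment o b = length-tabulate (index o b)

  toℕ-segment : ∀ o {h} (b : o + h ≤ q) {i} → i ∈ segment o b →
    ∃ λ (t : Fin h) → toℕ i ≡ at (o + toℕ t)
  toℕ-segment o b i∈ with ∈-tabulate⁻ {f = index o b} i∈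
  ... | t , eq = t , trans (cong toℕ eq) (toℕ-index o b t)

  segment-AllPairs : ∀ (R : ℕ → ℕ → Set) v {f : Fin n → ℕ} → (∀ i → f i ≡ v (toℕ i)) →
    Ordered R v c → ∀ o {h} (b : o + h ≤ q) → AllPairs (λ i j → R (f i) (f j)) (segment o b)
  segment-AllPairs R v {f} f≡v ord o {h} b = AllPairs.tabulate⁺-< λ {s} {t} s<t →
    subst₂ R (sym (at≡ s)) (sym (at≡ t)) (ord (+-monoʳ-< o s<t) (offset-< {o} {h} b t))
    where
    at≡ : ∀ t → f (index o b t) ≡ v (at (o + toℕ t))
    at≡ t = trans (f≡v _) (cong v (toℕ-index o b t))

module _ {π : List ℕ} {p q} (c : Chain p (length π) q) where
  open Chain c
  open Segments c

  -- The first h entries of the chain and the next h entries are the twins; their indices are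
  -- disjoint because `at` is strictly increasing.
  monotone-twins : ∀ {R τ} → Direction R τ → ¬ AllPairs R τ → Ordered R (valueAt π) c →
    ∀ h → h + h ≤ q → FreeTwins π τ h
  monotone-twins {R} {τ} dir ¬Rτ ord h 2h≤q = record
    { is = is ; js = js
    ; is-incr = incr 0 h≤q ; js-incr = incr h 2h≤q
    ; disjoint = disjoint
    ; len = length-segment 0 h≤q
    ; similar = similar (mono 0 h≤q) (mono h 2h≤q) lengths
    ; free = λ ρ ρ⊆ sim → ¬Rτ (inherits {ρ} sim (AllPairs-resp-⊆ ρ⊆ (mono 0 h≤q)))
    }
    where
    open Direction dir
    h≤q = ≤-trans (m≤m+n h h) 2h≤q
    is = segment 0 h≤q
    js = segment h 2h≤q
    incr : ∀ o (b : o + h ≤ q) → _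
    incr o b = AllPairs⇒Linked (segment-AllPairs _<_ id (λ _ → refl) at-mono o b)
    mono : ∀ o (b : o + h ≤ q) → AllPairs R (pick π (segment o b))
    mono o b = AllPairs.map⁺ (segment-AllPairs R (valueAt π) (lookup≡valueAt π) ord o b)
    lengths : length (pick π is) ≡ length (pick π js)
    lengths = trans (trans (length-map _ is) (length-segment 0 h≤q))
      (sym (trans (length-map _ js) (length-segment h 2h≤q)))
    disjoint : ∀ i → i ∈ is → i ∉ js
    disjoint i i∈is i∈js with toℕ-segment 0 h≤q i∈is | toℕ-segment h 2h≤q i∈js
    ... | s , eq | t , eq' = <-irrefl (trans (sym eq) eq')
      (at-mono (<-≤-trans (Fin.toℕ<n s) (m≤m+n h (toℕ t))) (offset-< {h} {h} 2h≤q t))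

twins-lower : ∀ {τ} → Unique τ → ¬ Monotone τ → ∀ {π} → Unique π → ∀ a h → h + h ≤ suc a →
  a * a < length π → FreeTwins π τ h
twins-lower {τ} τ! ¬mono {π} π! a h 2h≤ a²<n
  with erdős-szekeres (valueAt π) (length π) (valueAt-injective π!) a a (λ _ → true)
    (subst (a * a <_) (sym (trans (∑-const (length π) 1) (*-identityʳ (length π)))) a²<n)
... | inj₁ (c , ord) = monotone-twins {π} c (increasing τ) (¬mono ∘ inj₁ ∘ AllPairs⇒Linked) ord h 2h≤
... | inj₂ (c , ord) = monotone-twins {π} c (decreasing τ τ!) (¬mono ∘ inj₂ ∘ AllPairs⇒Linked) ord h 2h≤

-- The grid permutation

-- Both lists are free of repetitions and have the same members, because v is the image of `f v`.
involution-↭ : ∀ f n → (∀ i → i < n → f i < n) → (∀ i → f (f i) ≡ i) → applyUpTo f n ↭ upTo n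
involution-↭ f n f-< f-inv = ∼bag⇒↭ (unique∧set⇒bag
  (Unique.applyUpTo⁺₁ f n λ {i} {j} i<j _ fi≡fj →
    <-irrefl (trans (sym (f-inv i)) (trans (cong f fi≡fj) (f-inv j))) i<j)
  (Unique.upTo⁺ n)
  (λ {v} → mk⇔ to from))
  where
  to : ∀ {v} → v ∈ applyUpTo f n → v ∈ upTo n
  to v∈ with ∈-applyUpTo⁻ f v∈
  ... | i , i<n , refl = ∈-upTo⁺ (f-< i i<n)
  from : ∀ {v} → v ∈ upTo n → v ∈ applyUpTo f n
  from {v} v∈ = subst (_∈ applyUpTo f n) (f-inv v) (∈-applyUpTo⁺ f (f-< v (∈-upTo⁻ v∈)))

<ᵇ-true : ∀ {x y} → x < y → (x <ᵇ y) ≡ true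
<ᵇ-true x<y = Equivalence.to T-≡ (<⇒<ᵇ x<y)

true-<ᵇ : ∀ x y → (x <ᵇ y) ≡ true → x < y
true-<ᵇ x y eq = <ᵇ⇒< x y (Equivalence.from T-≡ eq)

does-true : ∀ {A : Set} (a? : Dec A) → does a? ≡ true → A
does-true (yes a) _ = a

module Grid (k : ℕ) .{{_ : NonZero k}} where

  -- Transposes the k × k grid whose cell (x , y) is the number x * k + y.
  swap : ℕ → ℕ
  swap p with p <? k * k
  ... | yes _ = (p % k) * k + p / k
  ... | no _  = p

  swap-cell : ∀ {x y} → x < k → y < k → swap (x * k + y) ≡ y * k + x
  swap-cell {x} {y} x<k y<k with x * k + y <? k * k
  ... | yes _ = cong₂ (λ r q → r * k + q) remainder quotient
    where
    remainder : (x * k + y) % k ≡ y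
    remainder = trans (cong (_% k) (+-comm (x * k) y)) (trans ([m+kn]%n≡m%n y x k) (m<n⇒m%n≡m y<k))
    quotient : (x * k + y) / k ≡ x
    quotient = trans (+-distrib-/-∣ˡ y (n∣m*n x))
      (trans (cong₂ _+_ (m*n/n≡m x k) (m<n⇒m/n≡0 y<k)) (+-identityʳ x))
  ... | no ≮ = ⊥-elim (≮ (<-≤-trans (block-< x k 0 x<k y<k) (≤-reflexive (+-identityʳ (k * k)))))

  swap-outside : ∀ {p} → ¬ p < k * k → swap p ≡ p
  swap-outside {p} p≮k² with p <? k * k
  ... | yes p<k² = ⊥-elim (p≮k² p<k²)
  ... | no _     = refl

  swap-involutive : ∀ p → swap (swap p) ≡ p
  swap-involutive p with p <? k * k
  ... | no p≮k² = swap-outside p≮k²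
  ... | yes p<k² = begin
    swap (p % k * k + p / k) ≡⟨ swap-cell (m%n<n p k) (m<n*o⇒m/o<n p<k²) ⟩
    p / k * k + p % k        ≡⟨ +-comm (p / k * k) (p % k) ⟩
    p % k + p / k * k        ≡⟨ m≡m%n+[m/n]*n p k ⟨
    p                        ∎
    where open ≡-Reasoning

  swap-< : ∀ {n} → k * k ≤ n → ∀ p → p < n → swap p < n
  swap-< k²≤n p p<n with p <? k * k
  ... | no _     = p<n
  ... | yes p<k² = <-≤-trans (block-< (p % k) k 0 (m%n<n p k) (m<n*o⇒m/o<n p<k²))
    (≤-trans (≤-reflexive (+-identityʳ (k * k))) k²≤n)

  grid : ℕ → List ℕ
  grid n = applyUpTo (suc ∘ swap) n

  grid-IsNPerm : ∀ {n} → k * k ≤ n → IsNPerm n (grid n)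
  grid-IsNPerm {n} k²≤n = subst (_↭ map suc (upTo n)) (map-applyUpTo swap suc n)
    (map⁺ suc (involution-↭ swap n (swap-< k²≤n) swap-involutive))

  -- The tests against k matter: `x * k + y` determines its cell only for y below k, and an
  -- occurrence in this unbounded matrix must lie inside the grid.
  gridMatrix : List ℕ → Matrix
  gridMatrix ps x y = (x <ᵇ k) ∧ ((y <ᵇ k) ∧ does (x * k + y ∈? ps))

  gridMatrix-true : ∀ ps {x y} → gridMatrix ps x y ≡ true → x < k × y < k × x * k + y ∈ ps
  gridMatrix-true ps {x} {y} eq = true-<ᵇ x k (∧-trueˡ (x <ᵇ k) eq) ,
    true-<ᵇ y k (∧-trueˡ (y <ᵇ k) eq') ,
    does-true (x * k + y ∈? ps) (∧-trueʳ (y <ᵇ k) eq')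
    where
    eq' = ∧-trueʳ (x <ᵇ k) eq

-- Counting the points of a τ-free sub-permutation of the grid.

sum≤∨ : ∀ a b → (a ≡ true → b ≡ true → ⊥) → ⟦ a ⟧ + ⟦ b ⟧ ≤ ⟦ a ∨ b ⟧
sum≤∨ true  true  ¬both = ⊥-elim (¬both refl refl)
sum≤∨ true  false _     = ≤-refl
sum≤∨ false b     _     = ≤-refl

length≤count : ∀ {n} ps → Unique ps → All (_< n) ps → length ps ≤ count (λ p → does (p ∈? ps)) n
length≤count         []       _           _             = z≤n
length≤count {n} (q ∷ ps) (q∉ps ∷ ps!) (q<n ∷ ps<n) = begin
  suc (length ps)
    ≤⟨ +-mono-≤ (point q<n) (length≤count ps ps! ps<n) ⟩
  count (λ p → does (p ≟ q)) n + count (λ p → does (p ∈? ps)) n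
    ≡⟨ ∑-+ n (λ p → ⟦ does (p ≟ q) ⟧) (λ p → ⟦ does (p ∈? ps) ⟧) ⟨
  ∑ n (λ p → ⟦ does (p ≟ q) ⟧ + ⟦ does (p ∈? ps) ⟧)
    ≤⟨ ∑-mono n (λ p _ → disjoint p) ⟩
  count (λ p → does (p ∈? q ∷ ps)) n ∎
  where
  open ≤-Reasoning
  point : ∀ {n} → q < n → 1 ≤ count (λ p → does (p ≟ q)) n
  point {suc n} q≤n with q ≟ n
  ... | yes refl rewrite dec-true (n ≟ n) refl = m≤n+m 1 _
  ... | no q≢n   = ≤-trans (point (≤∧≢⇒< (s≤s⁻¹ q≤n) q≢n)) (m≤m+n _ _)
  disjoint : ∀ p → ⟦ does (p ≟ q) ⟧ + ⟦ does (p ∈? ps) ⟧ ≤ ⟦ does (p ∈? q ∷ ps) ⟧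
  disjoint p = sum≤∨ (does (p ≟ q)) (does (p ∈? ps)) λ p≡q p∈ps →
    All.lookup q∉ps (does-true (p ∈? ps) p∈ps) (sym (does-true (p ≟ q) p≡q))

lookup≤sum : ∀ τ i → lookup τ i ≤ sum τ
lookup≤sum (t ∷ τ) Fin.zero    = m≤m+n t _
lookup≤sum (t ∷ τ) (Fin.suc i) = ≤-trans (lookup≤sum τ i) (m≤n+m _ t)

similar-tabulate : ∀ τ (f : Fin (length τ) → ℕ) →
  (∀ i j → i Fin.< j → f i < f j ⇔ lookup τ i < lookup τ j) → Similar (tabulate f) τ
similar-tabulate τ f h = eq , λ i j i<j →
  subst₂ (λ u v → u < v ⇔ lookup τ (cast eq i) < lookup τ (cast eq j)) (sym (at i)) (sym (at j))
    (h (cast eq i) (cast eq j) (cast-mono-< eq i j i<j))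
  where
  eq = length-tabulate f
  at : ∀ i → lookup (tabulate f) i ≡ f (cast eq i)
  at i = trans (cong (lookup (tabulate f)) (sym (Fin.cast-involutive (sym eq) eq i)))
    (lookup-tabulate f (cast eq i))

-- Both coordinates of the points (i , τ i) are at most patternBound τ.
patternBound constant : List ℕ → ℕ
patternBound τ = suc (length τ + sum τ)
constant τ = mtConstant (patternBound τ) * blockSize (patternBound τ) + 2

module _ (τ : List ℕ) (τ! : Unique τ) (k : ℕ) .{{_ : NonZero k}} (n : ℕ) where
  open Grid k

  -- The cells of an occurrence are selected points: their columns increase with the index in τ,
  -- which orders the positions, and their rows follow the entries of τ, which orders the values.
  -- Together they form a copy of τ.
  avoids⇒¬contains : ∀ is → AllPairs Fin._<_ is → Avoids (pick (grid n) is) τ →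
    ¬ Contains {Fin (length τ)} toℕ (lookup τ) (gridMatrix (map toℕ is))
  avoids⇒¬contains is is↗ avoid c = avoid (pick (grid n) (tabulate z))
    (Sublist.map⁺ (lookup (grid n)) (sorted-⊆ (AllPairs.tabulate⁺-< z-mono) is↗ z∈is))
    (subst (λ ρ → Similar ρ τ) (sym (map-tabulate z (lookup (grid n))))
      (similar-tabulate τ _ similar))
    where
    open Contains c
    cell∈ : ∀ i → x i < k × y i < k × x i * k + y i ∈ map toℕ is
    cell∈ i = gridMatrix-true (map toℕ is) (in-S i)
    position : ∀ i → ∃ λ z → z ∈ is × x i * k + y i ≡ toℕ z
    position i = ∈-map⁻ toℕ (proj₂ (proj₂ (cell∈ i)))
    z : Fin (length τ) → Fin (length (grid n))
    z i = proj₁ (position i)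
    z-mono : ∀ {i j} → i Fin.< j → z i Fin.< z j
    z-mono {i} {j} i<j = subst₂ _<_ (proj₂ (proj₂ (position i))) (proj₂ (proj₂ (position j)))
      (block-< (x i) (x j) (y j) (x-mono i j i<j) (proj₁ (proj₂ (cell∈ i))))
    z∈is : ∀ {j} → j ∈ tabulate z → j ∈ is
    z∈is j∈ with ∈-tabulate⁻ {f = z} j∈
    ... | i , refl = proj₁ (proj₂ (position i))
    value : ∀ i → lookup (grid n) (z i) ≡ suc (y i * k + x i)
    value i = trans (lookup-applyUpTo (suc ∘ swap) n (z i)) (cong suc
      (trans (cong swap (sym (proj₂ (proj₂ (position i)))))
        (swap-cell (proj₁ (cell∈ i)) (proj₁ (proj₂ (cell∈ i))))))
    value-mono : ∀ i j → lookup τ i < lookup τ j → lookup (grid n) (z i) < lookup (grid n) (z j)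
    value-mono i j τi<τj = subst₂ _<_ (sym (value i)) (sym (value j))
      (s≤s (block-< (y i) (y j) (x j) (y-mono i j τi<τj) (proj₁ (cell∈ i))))
    similar : ∀ i j → i Fin.< j →
      lookup (grid n) (z i) < lookup (grid n) (z j) ⇔ lookup τ i < lookup τ j
    similar i j i<j = mk⇔
      -- An occurrence gives only the implication from τ to the values. The converse follows since
      -- distinct entries of τ out of order would put the values out of order too.
      (λ lt → ≰⇒> (λ τj≤τi → <-asym lt
        (value-mono j i (≤∧≢⇒< τj≤τi (≢-sym (AllPairs-lookup τ! i j i<j))))))
      (value-mono i j)

  avoiding-length : k * k ≤ n → n ≤ k * k + 2 * k → ∀ is → AllPairs Fin._<_ is →
    Avoids (pick (grid n) is) τ → length is ≤ constant τ * k
  avoiding-length k²≤n n≤ is is↗ avoid = begin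
    length is
      ≡⟨ length-map toℕ is ⟨
    length ps
      ≤⟨ length≤count ps ps! ps<n ⟩
    count M n
      ≡⟨ cong (count M) (m+[n∸m]≡n k²≤n) ⟨
    count M (k * k + (n ∸ k * k))
      ≡⟨ ∑-split (k * k) (n ∸ k * k) _ ⟩
    count M (k * k) + count (λ i → M (k * k + i)) (n ∸ k * k)
      -- The points outside the grid are bounded by their total number, at most `2 * k`; this is the
      -- summand 2 of `constant`.
      ≤⟨ +-mono-≤ grid-part (≤-trans (count≤ _ (n ∸ k * k)) (m≤n+o⇒m∸n≤o n (k * k) n≤)) ⟩
    C * k + 2 * k
      ≡⟨ *-distribʳ-+ k C 2 ⟨
    constant τ * k ∎
    where
    open ≤-Reasoning
    q = patternBound τ
    C = mtConstant q * blockSize q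
    ps = map toℕ is
    M : ℕ → Bool
    M p = does (p ∈? ps)
    ps! : Unique ps
    ps! = AllPairs.map⁺ (AllPairs.map (λ i<j eq → <-irrefl eq i<j) is↗)
    ps<n : All (_< n) ps
    ps<n = All.tabulate λ p∈ → below (∈-map⁻ toℕ p∈)
      where
      below : ∀ {p} → ∃ (λ i → i ∈ is × p ≡ toℕ i) → p < n
      below (i , _ , refl) = subst (toℕ i <_) (length-applyUpTo _ n) (Fin.toℕ<n i)
    grid-part : count M (k * k) ≤ C * k
    grid-part = begin
      count M (k * k)
        ≡⟨ ∑-blocks k k (λ p → ⟦ M p ⟧) ⟩
      ∑ k (λ x → ∑ k (λ y → ⟦ M (x * k + y) ⟧))
        ≤⟨ ∑-mono k (λ x x<k → ∑-mono k (λ y y<k → ≤-reflexive (inside x<k y<k))) ⟩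
      mass k (gridMatrix ps)
        -- The `suc` in `patternBound` supplies q ≥ 1, so the block size is at least 2 and its
        -- powers grow.
        ≤⟨ marcus-tardos q (s≤s z≤n)
             (λ i → ≤-trans (<⇒≤ (Fin.toℕ<n i)) (m≤n⇒m≤1+n (m≤m+n (length τ) (sum τ))))
             (λ i → ≤-trans (lookup≤sum τ i) (m≤n⇒m≤1+n (m≤n+m (sum τ) (length τ))))
             k (gridMatrix ps) (avoids⇒¬contains is is↗ avoid) ⟩
      C * k ∎
      where
      inside : ∀ {x y} → x < k → y < k → ⟦ M (x * k + y) ⟧ ≡ ⟦ gridMatrix ps x y ⟧
      inside x<k y<k rewrite <ᵇ-true x<k | <ᵇ-true y<k = refl

-- Integer square roots and the two final estimates.

IsNPerm⇒Unique : ∀ {n π} → IsNPerm n π → Unique π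
IsNPerm⇒Unique {n} π↭ = PermutationSetoid.Unique-resp-↭ (setoid ℕ) (↭⇒↭ₛ (↭-sym π↭))
  (Unique.map⁺ suc-injective (Unique.upTo⁺ n))

IsNPerm⇒length : ∀ {n π} → IsNPerm n π → length π ≡ n
IsNPerm⇒length {n} π↭ = trans (↭-length π↭) (trans (length-map suc (upTo n)) (length-upTo n))

-- The upper condition says n < (k + 1)², so k is the integer square root; in this form it also
-- bounds the number of points outside the grid.
isqrt : ∀ n → ∃ λ k → k * k ≤ n × n ≤ k * k + 2 * k
isqrt zero    = 0 , z≤n , z≤n
isqrt (suc n) with isqrt n
... | k , k²≤n , n≤ with suc n ≤? k * k + 2 * k
...   | yes h = k , m≤n⇒m≤1+n k²≤n , h
...   | no h  = suc k , ≤-trans (≤-reflexive (square k)) (≰⇒> h) ,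
  ≤-trans (s≤s n≤) (≤-trans (≤-reflexive (sym (square k))) (m≤m+n _ _))
  where
  square : ∀ k → suc k * suc k ≡ suc (k * k + 2 * k)
  square = solve-∀

halve : ∀ k → ∃ λ h → 2 * h ≤ k × k ≤ 1 + 2 * h
halve zero          = 0 , z≤n , z≤n
halve (suc zero)    = 0 , z≤n , ≤-refl
halve (suc (suc k)) = let h , lo , hi = halve k in
  suc h , ≤-trans (≤-reflexive (double h)) (s≤s (s≤s lo)) ,
  ≤-trans (s≤s (s≤s hi)) (≤-reflexive (cong suc (sym (double h))))
  where
  double : ∀ h → 2 * suc h ≡ 2 + 2 * h
  double = solve-∀

-- From k ≤ 2h + 1 one gets n ≤ 4h² + 8h + 3, which is at most 15h² once h ≥ 1; the bound k ≥ 2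
-- excludes h = 0.
square-bound : ∀ {m n k h} → 2 ≤ k → k ≤ 1 + 2 * h → h ≤ m → n ≤ k * k + 2 * k → n ≤ 16 * (m * m)
square-bound {h = zero} 2≤k k≤1 _ _ with () ← s≤s⁻¹ (≤-trans 2≤k k≤1)
square-bound {m} {n} {k} {h@(suc h')} 2≤k k≤ h≤m n≤ = begin
  n                                         ≤⟨ n≤ ⟩
  k * k + 2 * k                             ≤⟨ +-mono-≤ (*-mono-≤ k≤ k≤) (*-monoʳ-≤ 2 k≤) ⟩
  (1 + 2 * h) * (1 + 2 * h) + 2 * (1 + 2 * h) ≤⟨ m≤m+n _ _ ⟩
  -- The added term is the slack 16h² - (4h² + 8h + 3), written in h' = h - 1 so that no subtraction
  -- occurs.
  (1 + 2 * h) * (1 + 2 * h) + 2 * (1 + 2 * h) + (12 * h' * h' + 16 * h' + 1) ≡⟨ expand h' ⟩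
  16 * (h * h)                              ≤⟨ *-monoʳ-≤ 16 (*-mono-≤ h≤m h≤m) ⟩
  16 * (m * m)                              ∎
  where
  open ≤-Reasoning
  expand : ∀ h' → (1 + 2 * suc h') * (1 + 2 * suc h') + 2 * (1 + 2 * suc h') +
    (12 * h' * h' + 16 * h' + 1) ≡ 16 * (suc h' * suc h')
  expand = solve-∀

twinMax-lower : ∀ {τ} → Unique τ → ¬ Monotone τ → ∀ {n π m} → IsNPerm n π → IsTwinMax π τ m →
  4 ≤ n → n ≤ 16 * (m * m)
twinMax-lower τ! ¬mono {n} {π} {m} π↭ (_ , max) 4≤n with isqrt n
... | zero        , _    , n≤ with () ← ≤-trans 4≤n n≤
... | suc zero    , _    , n≤ with s≤s (s≤s (s≤s ())) ← ≤-trans 4≤n n≤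
... | k@(suc k-1@(suc _)) , k²≤n , n≤ with halve k
-- Erdős-Szekeres is used with a = k - 1: as (k - 1)² < k² ≤ n, it gives a monotone chain of k
-- entries, room for two halves of length h.
...   | h , 2h≤k , k≤ = square-bound (s≤s (s≤s z≤n)) k≤ (max h (twins-lower τ! ¬mono
  (IsNPerm⇒Unique π↭) k-1 h (subst (_≤ k) (cong (h +_) (+-identityʳ h)) 2h≤k)
  (<-≤-trans (*-mono-< (n<1+n k-1) (n<1+n k-1)) (subst (k * k ≤_) (sym (IsNPerm⇒length π↭)) k²≤n)))) n≤

isT-upper : ∀ {τ} → Unique τ → (∀ π → FreeTwins π τ 0) → ∀ {n m} → 4 ≤ n → IsT n τ m →
  m * m ≤ constant τ * constant τ * n
isT-upper {τ} τ! empty {n} {m} 4≤n (_ , least) with isqrt n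
... | zero      , _    , n≤ with () ← ≤-trans 4≤n n≤
... | k@(suc _) , k²≤n , n≤ with twinMax τ empty (Grid.grid k n)
...   | m' , max@(twins , _) = begin
  m * m                               ≤⟨ *-mono-≤ m≤ m≤ ⟩
  constant τ * k * (constant τ * k)   ≡⟨ rearrange (constant τ) k ⟩
  constant τ * constant τ * (k * k)   ≤⟨ *-monoʳ-≤ (constant τ * constant τ) k²≤n ⟩
  constant τ * constant τ * n         ∎
  where
  open ≤-Reasoning
  open FreeTwins twins
  m≤ : m ≤ constant τ * k
  m≤ = begin
    m              ≤⟨ least (Grid.grid k n) m' (Grid.grid-IsNPerm k k²≤n) max ⟩
    m'             ≡⟨ len ⟨
    length is      ≤⟨ avoiding-length τ τ! k n k²≤n n≤ is (Linked⇒AllPairs Fin.<-trans is-incr) free ⟩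
    constant τ * k ∎
  rearrange : ∀ d k → d * k * (d * k) ≡ d * d * (k * k)
  rearrange = solve-∀

-- The empty pair makes the set of twin lengths nonempty, so that a maximum exists. It is τ-free
-- because an empty τ would be monotone.
noTwins : ∀ {τ} → ¬ Monotone τ → ∀ π → FreeTwins π τ 0
noTwins {τ} ¬mono π = record
  { is = [] ; js = [] ; is-incr = [] ; js-incr = [] ; disjoint = λ _ _ () ; len = refl
  ; similar = refl , λ ()
  ; free = λ ρ ρ⊆ sim → ¬mono (inj₁ (AllPairs⇒Linked
      (Direction.inherits (increasing τ) {ρ} sim (AllPairs-resp-⊆ ρ⊆ [])))) }

theorem2p5 : (τ : List ℕ) → IsPermutation τ → ¬ Monotone τ →
    Σ ℕ λ a → Σ ℕ λ b → Σ ℕ λ N →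
    ∀ n → N ≤ n →
    Σ ℕ λ m → IsT n τ m × (n ≤ a * (m * m)) × (m * m ≤ b * n)
-- The threshold 4 makes the integer square root of n at least 2, so the twins of the lower bound
-- have positive length.
theorem2p5 τ (τ! , _) ¬mono = 16 , constant τ * constant τ , 4 , λ n 4≤n →
  let m , isT@((_ , π↭ , max) , _) = isT-exists τ (noTwins ¬mono) n
  in m , isT , twinMax-lower τ! ¬mono π↭ max 4≤n , isT-upper τ! (noTwins ¬mono) 4≤n isT
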